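{- Let $P$ be a finite $(3+1)$-free poset with clone sets $C_1,\dots,C_r$ and tangles $T_1,\dots,T_s$ (the parts of $P$, which partition $P$). For each part $X$, regard $\mathrm{Aut}(X)$, the automorphism group of the induced subposet on $X$, as a group of permutations of $P$ acting as the identity on $P\setminus X$. Then each such permutation is an automorphism of $P$, and \[\mathrm{Aut}(P)=\prod_{i=1}^r\mathrm{Aut}(C_i)\times\prod_{j=1}^s\mathrm{Aut}(T_j),\] i.e. the natural map from this direct product to $\mathrm{Aut}(P)$ is a group isomorphism.
   Context: A poset $P$ is $(3+1)$-free if there are no $a,b,c,d\in P$ with $a<b<c$ and $d$ incomparable to each of $a,b,c$. For $a\in P$ let $D_a=\{x\in P:x<a\}$, $U_a=\{x\in P:x>a\}$. Write $a\mathrel{\top}b$ if neither of $D_a,D_b$ contains the other, $a\mathrel{\bot}b$ if neither of $U_a,U_b$ contains the other, and $a\approx b$ if $D_a=D_b$ and $U_a=U_b$. A top of a tangle is a subset $A\subseteq P$ with $|A|\ge2$ that is a connected component of the graph on $P$ with edges $\{a,b\}$ for $a\mathrel{\top}b$; a bottom of a tangle is defined in the same way using $\bot$. A top $A$ and bottom $B$ are matched if there are distinct $a_1,a_2\in A$, $b_1,b_2\in B$ with $b_1<a_1$, $b_2<a_2$ and the pairs $\{a_1,a_2\},\{b_1,b_2\},\{b_1,a_2\},\{b_2,a_1\}$ incomparable; in a $(3+1)$-free poset this is a perfect matching between tops and bottoms of tangles. A tangle is a matched pair $(A,B)$, identified with the set $A\cup B$ and its induced subposet. A clone set is an equivalence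 class of $\approx$ restricted to $P\setminus\bigcup_j (A_j\cup B_j)$, where $(A_j,B_j)$ range over the tangles. Clone sets and tangles are called the parts of $P$. -}

module Defs where

open import Level using (Level; 0ℓ; _⊔_)
open import Algebra.Bundles using (Group)
open import Algebra.Construct.DirectProduct using () renaming (group to _×ᴳ_)
import Algebra.Properties.Monoid.Sum as MonoidSum
open import Data.Fin.Base using (Fin)
open import Data.Fin.Subset using (Subset; _∈_; _∪_; ∣_∣)
open import Data.Fin.Subset.Properties using (_∈?_)
open import Data.Nat.Base as ℕ using (ℕ)
open import Data.Product.Base using (Σ; Σ-syntax; ∃-syntax; _×_; _,_; proj₁; proj₂; uncurry)
open import Data.Sum.Base using (_⊎_; inj₁; inj₂; [_,_]′)
open import Function.Base using (_∘_; id)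
open import Function.Bundles using (_⇔_)
open import Function.Definitions using (Injective)
open import Relation.Binary.Bundles using (Poset; DecPoset)
open import Relation.Binary.Core using (Rel)
open import Relation.Binary.Structures using (IsDecPartialOrder)
open import Relation.Binary.Construct.Closure.ReflexiveTransitive using (Star)
import Relation.Binary.Construct.NonStrictToStrict as ToStrict
import Relation.Binary.Construct.On as On
open import Relation.Binary.Morphism.Structures using (IsOrderIsomorphism)
import Relation.Binary.Morphism.Construct.Composition as Composition
import Relation.Binary.Morphism.Construct.Identity as Identity
open import Relation.Binary.PropositionalEquality.Core using (_≡_; _≢_)
open import Relation.Nullary.Decidable.Core using (yes; no)
open import Relation.Nullary.Negation.Core using (¬_)
open import Relation.Unary using (Pred; _⊆_; _≐_)

module _ {c ℓ₁ ℓ₂ : Level} (P : Poset c ℓ₁ ℓ₂) where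
  open Poset P

  IsAutomorphism : Pred (Carrier → Carrier) (c ⊔ ℓ₁ ⊔ ℓ₂)
  IsAutomorphism = IsOrderIsomorphism _≈_ _≈_ _≤_ _≤_

  Automorphism : Set (c ⊔ ℓ₁ ⊔ ℓ₂)
  Automorphism = Σ (Carrier → Carrier) IsAutomorphism

  private
    inverse : Automorphism → Automorphism
    inverse (f , isAut) = f⁻¹ , record
      { isOrderMonomorphism = record
        { isOrderHomomorphism = record
          { cong = λ {x} {y} x≈y → F.injective
              (Eq.trans (f∘f⁻¹ x) (Eq.trans x≈y (Eq.sym (f∘f⁻¹ y))))
          ; mono = λ {x} {y} x≤y → F.cancel
              (trans (reflexive (f∘f⁻¹ x)) (trans x≤y (reflexive (Eq.sym (f∘f⁻¹ y)))))
          }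
        ; injective = λ {x} {y} e →
            Eq.trans (Eq.sym (f∘f⁻¹ x)) (Eq.trans (F.cong e) (f∘f⁻¹ y))
        ; cancel = λ {x} {y} e →
            trans (reflexive (Eq.sym (f∘f⁻¹ x))) (trans (F.mono e) (reflexive (f∘f⁻¹ y)))
        }
      ; surjective = λ y → f y , λ {z} z≈fy → F.injective (Eq.trans (f∘f⁻¹ z) z≈fy)
      }
      where
      module F = IsOrderIsomorphism isAut
      f⁻¹ : Carrier → Carrier
      f⁻¹ y = proj₁ (F.surjective y)
      f∘f⁻¹ : ∀ y → f (f⁻¹ y) ≈ y
      f∘f⁻¹ y = proj₂ (F.surjective y) Eq.refl

  Aut : Group (c ⊔ ℓ₁ ⊔ ℓ₂) (c ⊔ ℓ₁)
  Aut = record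
    { Carrier = Automorphism
    ; _≈_     = λ σ τ → ∀ x → proj₁ σ x ≈ proj₁ τ x
    ; _∙_     = λ σ τ → proj₁ σ ∘ proj₁ τ ,
                        Composition.isOrderIsomorphism Eq.trans (proj₂ τ) (proj₂ σ)
    ; ε       = id , Identity.isOrderIsomorphism _≈_ _≤_ Eq.refl
    ; _⁻¹     = inverse
    ; isGroup = record
      { isMonoid = record
        { isSemigroup = record
          { isMagma = record
            { isEquivalence = record
              { refl  = λ x → Eq.refl
              ; sym   = λ p x → Eq.sym (p x)
              ; trans = λ p q x → Eq.trans (p x) (q x)
              }
            ; ∙-cong = λ {σ} {_} {_} {τ′} p q x →
                Eq.trans (IsOrderIsomorphism.cong (proj₂ σ) (q x)) (p (proj₁ τ′ x))
            }
          ; assoc = λ _ _ _ x → Eq.refl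
          }
        ; identity = (λ _ x → Eq.refl) , (λ _ x → Eq.refl)
        }
      ; inverse = (λ σ x → IsOrderIsomorphism.injective (proj₂ σ) (invʳ σ (proj₁ σ x)))
                , invʳ
      ; ⁻¹-cong = λ {σ} {τ} p x → IsOrderIsomorphism.injective (proj₂ σ)
          (Eq.trans (invʳ σ x) (Eq.trans (Eq.sym (invʳ τ x)) (Eq.sym (p _))))
      }
    }
    where
    invʳ : ∀ (σ : Automorphism) x → proj₁ σ (proj₁ (inverse σ) x) ≈ x
    invʳ σ x = proj₂ (IsOrderIsomorphism.surjective (proj₂ σ) x) Eq.refl

Πᴳ : ∀ {i c ℓ : Level} {I : Set i} → (I → Group c ℓ) → Group (i ⊔ c) (i ⊔ ℓ)
Πᴳ {I = I} G = record
  { Carrier = ∀ i → G.Carrier i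
  ; _≈_     = λ f g → ∀ i → G._≈_ i (f i) (g i)
  ; _∙_     = λ f g i → G._∙_ i (f i) (g i)
  ; ε       = λ i → G.ε i
  ; _⁻¹     = λ f i → G._⁻¹ i (f i)
  ; isGroup = record
    { isMonoid = record
      { isSemigroup = record
        { isMagma = record
          { isEquivalence = record
            { refl  = λ i → G.refl i
            ; sym   = λ p i → G.sym i (p i)
            ; trans = λ p q i → G.trans i (p i) (q i)
            }
          ; ∙-cong = λ p q i → G.∙-cong i (p i) (q i)
          }
        ; assoc = λ f g h i → G.assoc i (f i) (g i) (h i)
        }
      ; identity = (λ f i → G.identityˡ i (f i)) , (λ f i → G.identityʳ i (f i))
      }
    ; inverse = (λ f i → G.inverseˡ i (f i)) , (λ f i → G.inverseʳ i (f i))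
    ; ⁻¹-cong = λ p i → G.⁻¹-cong i (p i)
    }
  }
  where module G (i : I) = Group (G i)

IsComponent : ∀ {n} → Rel (Fin n) 0ℓ → Pred (Subset n) 0ℓ
IsComponent E A = ∃[ a ] ∀ x → x ∈ A ⇔ Star E a x

record Enumerates {a p} {A : Set a} (Q : Pred A p) {k : ℕ} (f : Fin k → A) : Set (a ⊔ p) where
  field
    sound     : ∀ i → Q (f i)
    injective : Injective _≡_ _≡_ f
    complete  : ∀ {x} → Q x → ∃[ i ] f i ≡ x

record FinPoset (n : ℕ) : Set₁ where
  infix 4 _≤_ _<_ _∥_ _⊤_ _⊥_ _≋_
  field
    _≤_               : Rel (Fin n) 0ℓ
    isDecPartialOrder : IsDecPartialOrder _≡_ _≤_

  decPoset : DecPoset 0ℓ 0ℓ 0ℓ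
  decPoset = record { isDecPartialOrder = isDecPartialOrder }

  poset : Poset 0ℓ 0ℓ 0ℓ
  poset = DecPoset.poset decPoset

  _<_ : Rel (Fin n) 0ℓ
  _<_ = ToStrict._<_ _≡_ _≤_

  _∥_ : Rel (Fin n) 0ℓ
  x ∥ y = ¬ (x ≤ y) × ¬ (y ≤ x)

  ThreePlusOneFree : Set
  ThreePlusOneFree = ∀ a b c d → ¬ (a < b × b < c × d ∥ a × d ∥ b × d ∥ c)

  D U : Fin n → Pred (Fin n) 0ℓ
  D a x = x < a
  U a x = a < x

  _⊤_ _⊥_ : Rel (Fin n) 0ℓ
  a ⊤ b = ¬ (D a ⊆ D b) × ¬ (D b ⊆ D a)
  a ⊥ b = ¬ (U a ⊆ U b) × ¬ (U b ⊆ U a)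

  -- The clone relation, written ≈ in the mathematics.
  _≋_ : Rel (Fin n) 0ℓ
  a ≋ b = D a ≐ D b × U a ≐ U b

  IsTop IsBottom : Pred (Subset n) 0ℓ
  IsTop    A = 2 ℕ.≤ ∣ A ∣ × IsComponent _⊤_ A
  IsBottom B = 2 ℕ.≤ ∣ B ∣ × IsComponent _⊥_ B

  Matched : Rel (Subset n) 0ℓ
  Matched A B = ∃[ a₁ ] ∃[ a₂ ] ∃[ b₁ ] ∃[ b₂ ]
    (a₁ ∈ A × a₂ ∈ A × a₁ ≢ a₂) × (b₁ ∈ B × b₂ ∈ B × b₁ ≢ b₂) ×
    (b₁ < a₁ × b₂ < a₂) × (a₁ ∥ a₂ × b₁ ∥ b₂ × b₁ ∥ a₂ × b₂ ∥ a₁)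

  IsTangle : Pred (Subset n × Subset n) 0ℓ
  IsTangle (A , B) = IsTop A × IsBottom B × Matched A B

  InNoTangle : Pred (Fin n) 0ℓ
  InNoTangle x = ∀ A B → IsTangle (A , B) → ¬ (x ∈ A ∪ B)

  IsCloneSet : Pred (Subset n) 0ℓ
  IsCloneSet C = ∃[ c ] InNoTangle c × (∀ x → x ∈ C ⇔ (InNoTangle x × x ≋ c))

  induced : Subset n → Poset 0ℓ 0ℓ 0ℓ
  induced X = On.poset poset (proj₁ {A = Fin n} {B = _∈ X})

  extend : (X : Subset n) → Automorphism (induced X) → Fin n → Fin n
  extend X (f , _) x with x ∈? X
  ... | yes x∈X = proj₁ (f (x , x∈X))
  ... | no  _   = x

  module Parts {r s : ℕ} (C : Fin r → Subset n) (T : Fin s → Subset n × Subset n) where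

    tangle : Fin s → Subset n
    tangle j = uncurry _∪_ (T j)

    part : Fin r ⊎ Fin s → Subset n
    part = [ C , tangle ]′

    ExtendsToAut : Set
    ExtendsToAut = ∀ k (σ : Automorphism (induced (part k))) →
                   IsAutomorphism poset (extend (part k) σ)

    ∏Aut : Group 0ℓ 0ℓ
    ∏Aut = Πᴳ (λ i → Aut (induced (C i))) ×ᴳ Πᴳ (λ j → Aut (induced (tangle j)))

    -- `sum` is the iterated operation of a monoid: here, composition in Aut(P).
    naturalMap : ExtendsToAut → Group.Carrier ∏Aut → Automorphism poset
    naturalMap ext (σ , τ) =
      ∏ (λ i → extend (C i) (σ i) , ext (inj₁ i) (σ i)) ∙
      ∏ (λ j → extend (tangle j) (τ j) , ext (inj₂ j) (τ j))
      where
      open Group (Aut poset) using (_∙_; monoid)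
      open MonoidSum monoid using () renaming (sum to ∏)

{-# OPTIONS --safe #-}

-- If a ⊤ b then U_a = U_b, since a point above a but not above b would complete a 3-chain
-- incomparable to b; dually a ⊥ b gives D_a = D_b, and no point lies on both a ⊤-edge and a
-- ⊥-edge. If x < a, x ≮ b, y < b and y ≮ a, then a ⊤ b and x ⊥ y, and all the points x, y
-- obtained in this way from one ⊤-component lie in one ⊥-component. So every ⊤-component is
-- matched with exactly one ⊥-component, and outside its tangle (A , B) all points of A (and all
-- points of B) have the same relations. Inside the tangle an automorphism keeps A and B apart
-- because it preserves such 2+2 patterns. Hence automorphisms of the parts extend to P.
--
-- Conversely, an automorphism φ of P fixes every part. If D_x and D_{φ x} are nested, then they
-- are equal since φ has finite order; otherwise x ⊤ φ x. In both cases φ x lies in the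
-- ⊤-component of x when x is on a ⊤-edge, and D_x = D_{φ x} when it is not; the same holds for
-- ⊥ and U. So φ is the composite of its restrictions to the parts.

module Submission where

open import Defs
open import Algebra.Bundles using (Group)
open import Algebra.Morphism.Structures using (module GroupMorphisms)
import Algebra.Properties.Group as GroupProperties
import Algebra.Properties.Monoid.Sum as MonoidSum
open import Data.Fin.Base using (Fin; toℕ; zero; suc)
open import Data.Fin.Properties using (all?; any?; pigeonhole; _≟_; sequence; suc-injective)
open import Data.Fin.Subset using (Subset; _∈_; _∉_; ∣_∣)
open import Data.Fin.Subset.Properties using (⊆-antisym; _∈?_; x∈p∪q⁻; x∈p∪q⁺; x∈p⇒∣p-x∣<∣p∣; x∈p∧x≢y⇒x∈p-y)
open import Data.Nat.Base as ℕ using (ℕ; zero; suc; z≤n; s≤s)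
open import Data.Nat.GeneralisedArithmetic using (fold; fold-+)
open import Data.Nat.Properties using (n<1+n; m≤n⇒∃[o]m+o≡n; +-suc; ≤-trans)
open import Data.Product using (Σ-syntax; ∃-syntax; ∃!; _×_; _,_; proj₁; proj₂; swap)
open import Data.Sum.Base using (_⊎_; inj₁; inj₂; [_,_]′)
open import Data.Sum.Properties using (inj₁-injective; inj₂-injective)
open import Data.Vec.Base using (tabulate)
open import Data.Vec.Properties using ([]=⇒lookup; lookup⇒[]=; lookup∘tabulate)
open import Effect.Monad using (RawMonad)
open import Function.Base using (flip; _∘_)
open import Function.Bundles using (_⇔_; mk⇔; Equivalence)
open import Function.Definitions using (Injective)
open import Level using (0ℓ)
open import Relation.Binary.Construct.Closure.ReflexiveTransitive using (Star; ε; _◅_; _◅◅_; reverse)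
import Relation.Binary.Construct.NonStrictToStrict as ToStrict
open import Relation.Binary.Core using (Rel)
open import Relation.Binary.Definitions using (Decidable; Reflexive; Symmetric; Transitive)
open import Relation.Binary.Morphism.Structures using (IsOrderIsomorphism)
open import Relation.Binary.PropositionalEquality using (_≡_; refl; sym; trans; cong; cong₂; subst; _≢_; ≢-sym)
open import Relation.Binary.Structures using (IsDecPartialOrder)
open import Relation.Nullary.Decidable using (yes; no; ¬?; _×-dec_; _→-dec_; map′; decidable-stable; does; dec-true; ¬¬-excluded-middle)
open import Relation.Nullary.Negation using (¬_; contradiction; ¬¬-Monad)
open import Relation.Unary as Unary using (Pred)

-- Orbits of an injective self-map of a finite set.

module _ {n} {φ : Fin n → Fin n} (φ-injective : Injective _≡_ _≡_ φ) where

  fold-injective : ∀ k → Injective _≡_ _≡_ (λ x → fold x φ k)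
  fold-injective zero    eq = eq
  fold-injective (suc k) eq = fold-injective k (φ-injective eq)

  -- Among `n + 1` iterates two coincide, and injectivity cancels the steps before the first of
  -- them.
  orbit-returns : ∀ x → ∃[ k ] fold x φ (suc k) ≡ x
  orbit-returns x with pigeonhole (n<1+n n) (λ i → fold x φ (toℕ i))
  ... | i , j , i<j , eq with m≤n⇒∃[o]m+o≡n i<j
  ... | k , i+k≡j = k , sym (fold-injective (toℕ i)
    (trans eq (trans (cong (fold x φ) (trans (sym i+k≡j) (sym (+-suc (toℕ i) k))))
                     (fold-+ x φ (toℕ i)))))

  module _ {R : Rel (Fin n) 0ℓ} (R-refl : Reflexive R) (R-trans : Transitive R)
           (φ-mono : ∀ {x y} → R x y → R (φ x) (φ y)) where

    -- Applying `φ` repeatedly to `R x (φ x)` gives an ascending chain along the orbit, which starts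
    -- at `φ x` and ends back at `x`.
    orbit-symmetric : ∀ {x} → R x (φ x) → R (φ x) x
    orbit-symmetric {x} xRφx with orbit-returns x
    ... | k , eq = subst (R (φ x)) eq (ascends k)
      where
      step : ∀ k → R (fold x φ k) (φ (fold x φ k))
      step zero    = xRφx
      step (suc k) = φ-mono (step k)

      ascends : ∀ k → R (φ x) (fold x φ (suc k))
      ascends zero    = R-refl
      ascends (suc k) = R-trans (ascends k) (step (suc k))

-- Strict (3+1)-free orders, crossings and tangles.

-- For the order _<_ of a poset, Crossing _<_ is ⊤ and Crossing (flip _<_) is ⊥.
module _ {n} (_≺_ : Rel (Fin n) 0ℓ) where

  Crossing : Rel (Fin n) 0ℓ
  Crossing a b = ¬ (∀ {x} → x ≺ a → x ≺ b) × ¬ (∀ {x} → x ≺ b → x ≺ a)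

  Incomparable : Rel (Fin n) 0ℓ
  Incomparable x y = ¬ (x ≺ y) × ¬ (y ≺ x)

  -- The 2+2 pattern by which a top and a bottom are matched. Over a poset, the other
  -- incomparabilities follow by transitivity.
  Square : (a₁ a₂ b₁ b₂ : Fin n) → Set
  Square a₁ a₂ b₁ b₂ = (b₁ ≺ a₁ × b₂ ≺ a₂) × (¬ (b₁ ≺ a₂) × ¬ (b₂ ≺ a₁))

-- The axioms are invariant under order reversal, so each result on ⊤ and down-sets yields, through
-- `dual`, the one on ⊥ and up-sets.
record FreeOrder (n : ℕ) : Set₁ where
  infix 4 _≺_ _≺?_
  field
    _≺_    : Rel (Fin n) 0ℓ
    _≺?_   : Decidable _≺_
    ≺-trans : Transitive _≺_
    free   : ∀ {a b c d} → a ≺ b → b ≺ c → Incomparable _≺_ d a →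
             Incomparable _≺_ d b → ¬ Incomparable _≺_ d c

dual : ∀ {n} → FreeOrder n → FreeOrder n
dual O = record
  { _≺_     = flip _≺_
  ; _≺?_    = flip _≺?_
  ; ≺-trans = flip ≺-trans
  ; free    = λ b≺a c≺b d∥a d∥b d∥c → free c≺b b≺a (swap d∥c) (swap d∥b) (swap d∥a)
  }
  where open FreeOrder O

record ClosedConnected {n} (E : Rel (Fin n) 0ℓ) (A : Subset n) : Set where
  field
    closed    : ∀ {x y} → x ∈ A → E x y → y ∈ A
    connected : ∀ {x y} → x ∈ A → y ∈ A → Star E x y

  star-closed : ∀ {x y} → x ∈ A → Star E x y → y ∈ A
  star-closed x∈A ε          = x∈A
  star-closed x∈A (xEz ◅ zy) = star-closed (closed x∈A xEz) zy

closedConnected-unique : ∀ {n} {E : Rel (Fin n) 0ℓ} {A A′ : Subset n} →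
  ClosedConnected E A → ClosedConnected E A′ → ∀ {x} → x ∈ A → x ∈ A′ → A ≡ A′
closedConnected-unique cA cA′ x∈A x∈A′ = ⊆-antisym
  (λ y∈A  → star-closed cA′ x∈A′ (connected cA  x∈A  y∈A))
  (λ y∈A′ → star-closed cA  x∈A  (connected cA′ x∈A′ y∈A′))
  where open ClosedConnected

record Tangle {n} (_≺_ : Rel (Fin n) 0ℓ) (A B : Subset n) : Set where
  field
    top    : ClosedConnected (Crossing _≺_) A
    bottom : ClosedConnected (Crossing (flip _≺_)) B
    {a₁ a₂ b₁ b₂} : Fin n
    a₁∈A   : a₁ ∈ A
    a₂∈A   : a₂ ∈ A
    b₁∈B   : b₁ ∈ B
    b₂∈B   : b₂ ∈ B
    square : Square _≺_ a₁ a₂ b₁ b₂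

module _ {n} {_≺_ : Rel (Fin n) 0ℓ} where

  square-sym : ∀ {a₁ a₂ b₁ b₂} → Square _≺_ a₁ a₂ b₁ b₂ → Square _≺_ a₂ a₁ b₂ b₁
  square-sym (p , q) = swap p , swap q

  square-dual : ∀ {a₁ a₂ b₁ b₂} → Square _≺_ a₁ a₂ b₁ b₂ → Square (flip _≺_) b₁ b₂ a₁ a₂
  square-dual (p , q) = p , swap q

  square⇒⊤ : ∀ {a₁ a₂ b₁ b₂} → Square _≺_ a₁ a₂ b₁ b₂ → Crossing _≺_ a₁ a₂
  square⇒⊤ ((b₁≺a₁ , b₂≺a₂) , (b₁⊀a₂ , b₂⊀a₁)) =
    (λ D⊆ → b₁⊀a₂ (D⊆ b₁≺a₁)) , (λ D⊆ → b₂⊀a₁ (D⊆ b₂≺a₂))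

square⇒⊥ : ∀ {n} {_≺_ : Rel (Fin n) 0ℓ} {a₁ a₂ b₁ b₂} →
           Square _≺_ a₁ a₂ b₁ b₂ → Crossing (flip _≺_) b₁ b₂
square⇒⊥ {_≺_ = _≺_} sq = square⇒⊤ {_≺_ = flip _≺_} (square-dual {_≺_ = _≺_} sq)

tangle-dual : ∀ {n} {_≺_ : Rel (Fin n) 0ℓ} {A B} → Tangle _≺_ A B → Tangle (flip _≺_) B A
tangle-dual {_≺_ = _≺_} t = record
  { top = bottom ; bottom = top ; a₁∈A = b₁∈B ; a₂∈A = b₂∈B ; b₁∈B = a₁∈A ; b₂∈B = a₂∈A
  ; square = square-dual {_≺_ = _≺_} square }
  where open Tangle t

-- The components of ⊤ in a (3+1)-free order.

module Crossings {n} (O : FreeOrder n) where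
  open FreeOrder O

  private
    _⊤_ _⊥_ : Rel (Fin n) 0ℓ
    _⊤_ = Crossing _≺_
    _⊥_ = Crossing (flip _≺_)

  ⊆-dec : Decidable (λ a b → ∀ {x} → x ≺ a → x ≺ b)
  ⊆-dec a b = map′ (λ f {x} → f x) (λ f x → f {x}) (all? (λ x → (x ≺? a) →-dec (x ≺? b)))

  crossing? : Decidable _⊤_
  crossing? a b = ¬? (⊆-dec a b) ×-dec ¬? (⊆-dec b a)

  ⊈-witness : ∀ {a b} → ¬ (∀ {x} → x ≺ a → x ≺ b) → ∃[ x ] (x ≺ a × ¬ (x ≺ b))
  ⊈-witness {a} {b} D⊈ = decidable-stable (any? (λ x → (x ≺? a) ×-dec ¬? (x ≺? b)))
    (λ none → D⊈ λ {x} x≺a → decidable-stable (x ≺? b) λ x⊀b → none (x , x≺a , x⊀b))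

  crossing⇒square : ∀ {a b} → a ⊤ b → ∃[ x ] ∃[ y ] Square _≺_ a b x y
  crossing⇒square (a⊈b , b⊈a) with ⊈-witness a⊈b | ⊈-witness b⊈a
  ... | x , x≺a , x⊀b | y , y≺b , y⊀a = x , y , (x≺a , y≺b) , (x⊀b , y⊀a)

  -- If z were above a but not above b, the chain x ≺ a ≺ z with x below a but not below b
  -- would be incomparable to b.
  crossing⇒above : ∀ {a b z} → a ⊤ b → a ≺ z → b ≺ z
  crossing⇒above {a} {b} {z} a⊤b a≺z with crossing⇒square a⊤b
  ... | x , y , (x≺a , y≺b) , (x⊀b , y⊀a) = decidable-stable (b ≺? z) λ b⊀z →
    free x≺a a≺z
      ((λ b≺x → y⊀a (≺-trans y≺b (≺-trans b≺x x≺a))) , x⊀b)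
      ((λ b≺a → y⊀a (≺-trans y≺b b≺a)) , (λ a≺b → x⊀b (≺-trans x≺a a≺b)))
      (b⊀z , (λ z≺b → x⊀b (≺-trans x≺a (≺-trans a≺z z≺b))))

  star⇒above : ∀ {a b z} → Star _⊤_ a b → a ≺ z → b ≺ z
  star⇒above ε          a≺z = a≺z
  star⇒above (a⊤c ◅ cb) a≺z = star⇒above cb (crossing⇒above a⊤c a≺z)

  -- Both `y` and `u` lie below the shared top `a₂`. If `u` is not below `a₁`, then `x` is
  -- ⊥-adjacent to both; if `y` is not below `a₃`, then `v` is. Otherwise `a₁` and `a₃` themselves
  -- witness that `y` and `u` are ⊥-adjacent.
  square-bottoms-linked : ∀ {a₁ a₂ a₃ x y u v} →
    Square _≺_ a₁ a₂ x y → Square _≺_ a₂ a₃ u v → Star _⊥_ y u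
  square-bottoms-linked {a₁} {a₂} {a₃} {x} {y} {u} {v}
    s@((x≺a₁ , y≺a₂) , (x⊀a₂ , y⊀a₁)) t@((u≺a₂ , v≺a₃) , (u⊀a₃ , v⊀a₂))
    with u ≺? a₁ | y ≺? a₃
  ... | no u⊀a₁  | _        = swap (square⇒⊥ {_≺_ = _≺_} s) ◅
                              square⇒⊥ {_≺_ = _≺_} ((x≺a₁ , u≺a₂) , (x⊀a₂ , u⊀a₁)) ◅ ε
  ... | yes u≺a₁ | yes y≺a₃ = swap (square⇒⊥ {_≺_ = _≺_} ((u≺a₁ , y≺a₃) , (u⊀a₃ , y⊀a₁))) ◅ ε
  ... | yes u≺a₁ | no y⊀a₃  = square⇒⊥ {_≺_ = _≺_} ((y≺a₂ , v≺a₃) , (y⊀a₃ , v⊀a₂)) ◅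
                              swap (square⇒⊥ {_≺_ = _≺_} t) ◅ ε

  -- Each edge of the ⊤-path carries a square, and squares of consecutive edges share a top, so
  -- their bottoms are linked in turn.
  star⇒bottoms-linked : ∀ {a a′ c c′ x x′ y y′} → Star _⊤_ a c →
    Square _≺_ a a′ x x′ → Square _≺_ c c′ y y′ → Star _⊥_ x y
  star⇒bottoms-linked ε s t = square-bottoms-linked (square-sym {_≺_ = _≺_} s) t
  star⇒bottoms-linked (a⊤d ◅ dc) s t with crossing⇒square a⊤d
  ... | u , v , q = square-bottoms-linked (square-sym {_≺_ = _≺_} s) q ◅◅
    square⇒⊥ {_≺_ = _≺_} q ◅ star⇒bottoms-linked dc (square-sym {_≺_ = _≺_} q) t

  module _ {A B : Subset n} (t : Tangle _≺_ A B) where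
    open Tangle t
    open ClosedConnected

    top-crossing : ∀ {a} → a ∈ A → ∃[ b ] a ⊤ b
    top-crossing a∈A with connected top a∈A a₁∈A
    ... | ε       = a₂ , square⇒⊤ {_≺_ = _≺_} square
    ... | a⊤b ◅ _ = _ , a⊤b

    -- Comparison with the tangle's own square: this is what makes `B` the only ⊥-component matched
    -- with `A`.
    square-bottom : ∀ {a a′ x x′} → a ∈ A → Square _≺_ a a′ x x′ → x ∈ B
    square-bottom a∈A s =
      star-closed bottom b₁∈B (star⇒bottoms-linked (connected top a₁∈A a∈A) square s)

    top-below-outside : ∀ {a a′ y} → a ∈ A → a′ ∈ A → y ∉ B → y ≺ a → y ≺ a′
    top-below-outside {y = y} a∈A a′∈A y∉B = go a∈A (connected top a∈A a′∈A)
      where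
      go : ∀ {a a′} → a ∈ A → Star _⊤_ a a′ → y ≺ a → y ≺ a′
      go a∈A ε y≺a = y≺a
      go {a} a∈A (_◅_ {j = d} a⊤d da′) y≺a = go (closed top a∈A a⊤d) da′
        -- If `y` were below `a` but not below `d`, it would form a square with some `v` below `d`
        -- but not below `a`, which would put `y` into `B`.
        (decidable-stable (y ≺? d) λ y⊀d → let v , v≺d , v⊀a = ⊈-witness (proj₂ a⊤d) in
          y∉B (square-bottom a∈A ((y≺a , v≺d) , (y⊀d , v⊀a))))

  module _ {φ : Fin n → Fin n} (φ-injective : Injective _≡_ _≡_ φ)
           (φ-surjective : ∀ y → ∃[ x ] φ x ≡ y)
           (φ-mono : ∀ {x y} → x ≺ y → φ x ≺ φ y)
           (φ-cancel : ∀ {x y} → φ x ≺ φ y → x ≺ y) where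

    private
      _⊑_ : Rel (Fin n) 0ℓ
      a ⊑ b = ∀ x → x ≺ a → x ≺ b

      ⊑-mono : ∀ {a b} → a ⊑ b → φ a ⊑ φ b
      ⊑-mono a⊑b x x≺φa with φ-surjective x
      ... | x′ , refl = φ-mono (a⊑b x′ (φ-cancel x≺φa))

      ⊑-trans : Transitive _⊑_
      ⊑-trans p q x = q x ∘ p x

    -- Down-sets of x and φ x, if nested, are equal because φ has finite order on x.
    nested⇒equal : ∀ {x} → ¬ (x ⊤ φ x) → ∀ y → (y ≺ x → y ≺ φ x) × (y ≺ φ x → y ≺ x)
    nested⇒equal {x} ¬⊤ y with ⊆-dec x (φ x) | ⊆-dec (φ x) x
    ... | yes p | _     = p , orbit-symmetric φ-injective {R = _⊑_} (λ _ z → z)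
                                ⊑-trans ⊑-mono (λ _ → p) y
    ... | no _  | yes q = orbit-symmetric φ-injective {R = flip _⊑_} (λ _ z → z)
                            (flip ⊑-trans) ⊑-mono (λ _ → q) y , q
    ... | no p  | no q  = contradiction (p , q) ¬⊤

    -- Either `x` crosses `φ x`, or both have the same down-set and `φ x` crosses whatever `x`
    -- crosses. In each case a path of at most two ⊤-edges leads from `x` to `φ x`.
    crossing-closed-invariant : ∀ {A} → ClosedConnected _⊤_ A → (∀ {a} → a ∈ A → ∃[ b ] a ⊤ b) →
      ∀ {x} → x ∈ A → φ x ∈ A
    crossing-closed-invariant cA partner {x} x∈A with crossing? x (φ x)
    ... | yes x⊤φx = ClosedConnected.closed cA x∈A x⊤φx
    ... | no ¬x⊤φx with partner x∈A
    ...   | b , (x⊈b , b⊈x) = ClosedConnected.closed cA (ClosedConnected.closed cA x∈A (x⊈b , b⊈x))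
      ((λ b⊆φx → b⊈x λ {y} y≺b → proj₂ (nested⇒equal ¬x⊤φx y) (b⊆φx y≺b)) ,
       (λ φx⊆b → x⊈b λ {y} y≺x → φx⊆b (proj₁ (nested⇒equal ¬x⊤φx y) y≺x)))

-- Interaction of ⊤-edges and ⊥-edges.

module _ {n} (O : FreeOrder n) where
  open FreeOrder O
  private
    module Down = Crossings O
    module Up   = Crossings (dual O)

  -- If y ≺ b with y not below a, and a ≺ z with c not below z, then y ≺ b ≺ z is incomparable to c.
  no-⊤-and-⊥ : ∀ {a b c} → Crossing _≺_ a b → ¬ Crossing (flip _≺_) a c
  no-⊤-and-⊥ {a} {b} {c} a⊤b a⊥c with Down.crossing⇒square a⊤b | Up.crossing⇒square a⊥c
  ... | x , y , (x≺a , y≺b) , (x⊀b , y⊀a) | z , w , (a≺z , c≺w) , (c⊀z , a⊀w) =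
    free y≺b b≺z
      ((λ c≺y → c⊀z (≺-trans c≺y (≺-trans y≺b b≺z))) , y⊀c)
      ((λ c≺b → c⊀z (≺-trans c≺b b≺z)) , (λ b≺c → y⊀c (≺-trans y≺b b≺c)))
      (c⊀z , (λ z≺c → a⊀w (≺-trans a≺z (≺-trans z≺c c≺w))))
    where
    b≺z = Down.crossing⇒above a⊤b a≺z
    y⊀c : ¬ (y ≺ c)
    y⊀c y≺c = y⊀a (Up.crossing⇒above (swap a⊥c) y≺c)

  top-bottom-disjoint : ∀ {A B A′ B′} → Tangle _≺_ A B → Tangle _≺_ A′ B′ →
    ∀ {x} → x ∈ A → x ∉ B′
  top-bottom-disjoint t t′ x∈A x∈B′ = no-⊤-and-⊥
    (proj₂ (Down.top-crossing t x∈A)) (proj₂ (Up.top-crossing (tangle-dual t′) x∈B′))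

  -- Components that meet are equal, so the tops agree; the square of the first tangle then puts
  -- `b₁` into both bottoms.
  top-determines-tangle : ∀ {A B A′ B′} → Tangle _≺_ A B → Tangle _≺_ A′ B′ →
    ∀ {x} → x ∈ A → x ∈ A′ → A ≡ A′ × B ≡ B′
  top-determines-tangle t t′ x∈A x∈A′
    with closedConnected-unique (Tangle.top t) (Tangle.top t′) x∈A x∈A′
  ... | refl = refl , closedConnected-unique (Tangle.bottom t) (Tangle.bottom t′) (Tangle.b₁∈B t)
                        (Down.square-bottom t′ (Tangle.a₁∈A t) (Tangle.square t))

  -- A point of the top crosses another one inside the tangle, and g preserves this square.
  top-preserved : ∀ {A B} → Tangle _≺_ A B → (g : Fin n → Fin n) →
    (∀ {a} → a ∈ A → g a ∈ A ⊎ g a ∈ B) →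
    (∀ {a b} → a ∈ A → b ∈ B → (b ≺ a → g b ≺ g a) × (g b ≺ g a → b ≺ a)) →
    ∀ {a} → a ∈ A → g a ∈ A
  top-preserved {A} {B} t g g-into g-resp {a} a∈A with g-into a∈A
  ... | inj₁ ga∈A = ga∈A
  ... | inj₂ ga∈B with Down.top-crossing t a∈A
  ...   | a′ , a⊤a′ with Down.crossing⇒square a⊤a′
  ...     | x , x′ , s@((x≺a , x′≺a′) , (x⊀a′ , x′⊀a)) =
    contradiction (proj₂ (Up.top-crossing (tangle-dual t) ga∈B)) (no-⊤-and-⊥ (square⇒⊤ {_≺_ = _≺_}
      ((proj₁ (g-resp a∈A x∈B) x≺a , proj₁ (g-resp a′∈A x′∈B) x′≺a′) ,
       (x⊀a′ ∘ proj₂ (g-resp a′∈A x∈B) , x′⊀a ∘ proj₂ (g-resp a∈A x′∈B)))))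
    where
    a′∈A = ClosedConnected.closed (Tangle.top t) a∈A a⊤a′
    x∈B  = Down.square-bottom t a∈A s
    x′∈B = Down.square-bottom t a′∈A (square-sym {_≺_ = _≺_} s)

-- Subsets of a finite set and components of a graph on it.

module _ {n} {Q : Pred (Fin n) 0ℓ} (Q? : Unary.Decidable Q) where

  comprehension : Subset n
  comprehension = tabulate (does ∘ Q?)

  ∈-comprehension : ∀ x → x ∈ comprehension ⇔ Q x
  ∈-comprehension x = mk⇔ to from
    where
    to : x ∈ comprehension → Q x
    to x∈ with Q? x | trans (sym (lookup∘tabulate (does ∘ Q?) x)) ([]=⇒lookup x∈)
    ... | yes q | _  = q
    ... | no _  | ()

    from : Q x → x ∈ comprehension
    from q = lookup⇒[]= x _ (trans (lookup∘tabulate (does ∘ Q?) x) (dec-true (Q? x) q))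

2≤∣p∣ : ∀ {n} {p : Subset n} {x y} → x ∈ p → y ∈ p → x ≢ y → 2 ℕ.≤ ∣ p ∣
2≤∣p∣ x∈p y∈p x≢y = ≤-trans
  (s≤s (≤-trans (s≤s z≤n) (x∈p⇒∣p-x∣<∣p∣ (x∈p∧x≢y⇒x∈p-y y∈p (≢-sym x≢y)))))
  (x∈p⇒∣p-x∣<∣p∣ x∈p)

-- Over a finite index type double negation commutes with the universal quantifier, so the pointwise
-- instances of excluded middle can be collected.
¬¬-decide : ∀ {n} (Q : Pred (Fin n) 0ℓ) → ¬ ¬ Unary.Decidable Q
¬¬-decide Q = sequence (RawMonad.rawApplicative ¬¬-Monad) (λ _ → ¬¬-excluded-middle)

isComponent⇒closedConnected : ∀ {n} {E : Rel (Fin n) 0ℓ} {A} → Symmetric E →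
  IsComponent E A → ClosedConnected E A
isComponent⇒closedConnected E-sym (a , A⇔) = record
  { closed    = λ {x} {y} x∈A xEy →
      Equivalence.from (A⇔ y) (Equivalence.to (A⇔ x) x∈A ◅◅ xEy ◅ ε)
  ; connected = λ {x} {y} x∈A y∈A →
      reverse E-sym (Equivalence.to (A⇔ x) x∈A) ◅◅ Equivalence.to (A⇔ y) y∈A
  }

-- From finite posets to strict orders and tangles.

module _ {n} (P : FinPoset n) where
  open FinPoset P
  open IsDecPartialOrder isDecPartialOrder using (isPartialOrder; antisym; reflexive; _≤?_)
    renaming (trans to ≤ᴾ-trans)

  <-≤-trans : ∀ {x y z} → x < y → y ≤ z → x < z
  <-≤-trans = ToStrict.<-≤-trans _≡_ _≤_ sym ≤ᴾ-trans antisym (λ {refl p → p})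

  ≤-<-trans : ∀ {x y z} → x ≤ y → y < z → x < z
  ≤-<-trans = ToStrict.≤-<-trans _≡_ _≤_ ≤ᴾ-trans antisym (λ {refl p → p})

  strictOrder : ThreePlusOneFree → FreeOrder n
  strictOrder P-free = record
    { _≺_     = _<_
    ; _≺?_    = ToStrict.<-decidable _≡_ _≤_ _≟_ _≤?_
    -- `Incomparable _<_` holds for equal points as well. In `free`, a `d` equal to a member of the
    -- chain is ruled out, being comparable to a neighbour of that member.
    ; ≺-trans = ToStrict.<-trans _≡_ _≤_ isPartialOrder
    ; free    = λ a<b b<c d∥a d∥b d∥c → P-free _ _ _ _
        ( a<b , b<c
        , strengthen d∥a (λ { refl → proj₁ d∥b a<b })
        , strengthen d∥b (λ { refl → proj₁ d∥c b<c })
        , strengthen d∥c (λ { refl → proj₂ d∥b b<c }))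
    }
    where
    strengthen : ∀ {x y} → Incomparable _<_ x y → x ≢ y → x ∥ y
    strengthen (x≮y , y≮x) x≢y = (λ x≤y → x≮y (x≤y , x≢y)) , (λ y≤x → y≮x (y≤x , ≢-sym x≢y))

  isTangle⇒tangle : ∀ {A B} → IsTangle (A , B) → Tangle _<_ A B
  isTangle⇒tangle
    ( (_ , compA) , (_ , compB)
    , a₁ , a₂ , b₁ , b₂ , (a₁∈A , a₂∈A , _) , (b₁∈B , b₂∈B , _) , p , _ , _ , b₁∥a₂ , b₂∥a₁) = record
    { top    = isComponent⇒closedConnected swap compA
    ; bottom = isComponent⇒closedConnected swap compB
    ; a₁∈A = a₁∈A ; a₂∈A = a₂∈A ; b₁∈B = b₁∈B ; b₂∈B = b₂∈B
    ; square = p , (proj₁ b₁∥a₂ ∘ proj₁ , proj₁ b₂∥a₁ ∘ proj₁)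
    }

  -- Reachability is only decided up to double negation, which suffices to refute InNoTangle.
  square⇒¬¬tangle : ∀ {a₁ a₂ b₁ b₂} → Square _<_ a₁ a₂ b₁ b₂ →
    ¬ ¬ (∃[ A ] ∃[ B ] (IsTangle (A , B) × a₁ ∈ A × b₁ ∈ B))
  square⇒¬¬tangle {a₁} {a₂} {b₁} {b₂} sq@((b₁<a₁ , b₂<a₂) , (b₁≮a₂ , b₂≮a₁)) none =
    ¬¬-decide (Star _⊤_ a₁) λ A? → ¬¬-decide (Star _⊥_ b₁) λ B? →
    let A  = comprehension A?
        B  = comprehension B?
        inA = λ x → Equivalence.from (∈-comprehension A? x)
        inB = λ x → Equivalence.from (∈-comprehension B? x)
        a₁∈A = inA a₁ ε
        a₂∈A = inA a₂ (square⇒⊤ {_≺_ = _<_} sq ◅ ε)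
        b₁∈B = inB b₁ ε
        b₂∈B = inB b₂ (square⇒⊥ {_≺_ = _<_} sq ◅ ε)
    in none (A , B ,
      ( (2≤∣p∣ a₁∈A a₂∈A a₁≢a₂ , a₁ , ∈-comprehension A?)
      , (2≤∣p∣ b₁∈B b₂∈B b₁≢b₂ , b₁ , ∈-comprehension B?)
      , a₁ , a₂ , b₁ , b₂ , (a₁∈A , a₂∈A , a₁≢a₂) , (b₁∈B , b₂∈B , b₁≢b₂)
      , (b₁<a₁ , b₂<a₂)
      , ( (λ a₁≤a₂ → b₁≮a₂ (<-≤-trans b₁<a₁ a₁≤a₂))
        , (λ a₂≤a₁ → b₂≮a₁ (<-≤-trans b₂<a₂ a₂≤a₁)))
      , ( (λ b₁≤b₂ → b₁≮a₂ (≤-<-trans b₁≤b₂ b₂<a₂))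
        , (λ b₂≤b₁ → b₂≮a₁ (≤-<-trans b₂≤b₁ b₁<a₁)))
      , ( (λ b₁≤a₂ → b₁≮a₂ (b₁≤a₂ , λ { refl → b₂≮a₁ (<-≤-trans b₂<a₂ (proj₁ b₁<a₁)) }))
        , (λ a₂≤b₁ → b₂≮a₁ (<-≤-trans b₂<a₂ (proj₁ (≤-<-trans a₂≤b₁ b₁<a₁)))))
      , ( (λ b₂≤a₁ → b₂≮a₁ (b₂≤a₁ , λ { refl → b₁≮a₂ (<-≤-trans b₁<a₁ (proj₁ b₂<a₂)) }))
        , (λ a₁≤b₂ → b₁≮a₂ (<-≤-trans b₁<a₁ (proj₁ (≤-<-trans a₁≤b₂ b₂<a₂))))))
      , a₁∈A , b₁∈B)
    where
    a₁≢a₂ : a₁ ≢ a₂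
    a₁≢a₂ refl = b₁≮a₂ b₁<a₁
    b₁≢b₂ : b₁ ≢ b₂
    b₁≢b₂ refl = b₁≮a₂ b₂<a₂

  -- Extending automorphisms of a subset by the identity.

  module _ (X : Subset n) where
    private
      module AutX = Group (Aut (induced X))

    extend-∈ : ∀ σ {x} (x∈X : x ∈ X) → extend X σ x ≡ proj₁ (proj₁ σ (x , x∈X))
    extend-∈ (f , isAut) {x} x∈X with x ∈? X
    ... | yes _   = IsOrderIsomorphism.cong isAut refl
    ... | no  x∉X = contradiction x∈X x∉X

    extend-∉ : ∀ σ {x} → x ∉ X → extend X σ x ≡ x
    extend-∉ σ {x} x∉X with x ∈? X
    ... | yes x∈X = contradiction x∈X x∉X
    ... | no  _   = refl

    extend-into : ∀ σ {x} → x ∈ X → extend X σ x ∈ X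
    extend-into σ x∈X = subst (_∈ X) (sym (extend-∈ σ x∈X)) (proj₂ (proj₁ σ (_ , x∈X)))

    extend-cong : ∀ {σ τ} → σ AutX.≈ τ → ∀ x → extend X σ x ≡ extend X τ x
    extend-cong σ≈τ x with x ∈? X
    ... | yes x∈X = σ≈τ (x , x∈X)
    ... | no  _   = refl

    extend-∙ : ∀ σ τ x → extend X (σ AutX.∙ τ) x ≡ extend X σ (extend X τ x)
    extend-∙ σ τ x with x ∈? X
    ... | yes x∈X = sym (extend-∈ σ (proj₂ (proj₁ τ (x , x∈X))))
    ... | no  x∉X = sym (extend-∉ σ x∉X)

    extend-ε : ∀ x → extend X AutX.ε x ≡ x
    extend-ε x with x ∈? X
    ... | yes _ = refl
    ... | no  _ = refl

    extend-inverseˡ : ∀ σ x → extend X (σ AutX.⁻¹) (extend X σ x) ≡ x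
    extend-inverseˡ σ x = trans (sym (extend-∙ (σ AutX.⁻¹) σ x))
      (trans (extend-cong {(σ AutX.⁻¹) AutX.∙ σ} {AutX.ε} (AutX.inverseˡ σ) x) (extend-ε x))

    extend-inverseʳ : ∀ σ x → extend X σ (extend X (σ AutX.⁻¹) x) ≡ x
    extend-inverseʳ σ x = trans (sym (extend-∙ σ (σ AutX.⁻¹) x))
      (trans (extend-cong {σ AutX.∙ (σ AutX.⁻¹)} {AutX.ε} (AutX.inverseʳ σ) x) (extend-ε x))

    extend-mono-∈ : ∀ σ {x y} → x ∈ X → y ∈ X → x ≤ y → extend X σ x ≤ extend X σ y
    extend-mono-∈ σ x∈X y∈X x≤y rewrite extend-∈ σ x∈X | extend-∈ σ y∈X =
      IsOrderIsomorphism.mono (proj₂ σ) x≤y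

    extend-mono-<-∈ : ∀ σ {x y} → x ∈ X → y ∈ X → x < y → extend X σ x < extend X σ y
    extend-mono-<-∈ σ {x} {y} x∈X y∈X (x≤y , x≢y) = extend-mono-∈ σ x∈X y∈X x≤y ,
      λ eq → x≢y (trans (sym (extend-inverseˡ σ x))
                        (trans (cong (extend X (σ AutX.⁻¹)) eq) (extend-inverseˡ σ y)))

    extend-cancel-<-∈ : ∀ σ {x y} → x ∈ X → y ∈ X → extend X σ x < extend X σ y → x < y
    extend-cancel-<-∈ σ {x} {y} x∈X y∈X σx<σy
      with extend-mono-<-∈ (σ AutX.⁻¹) (extend-into σ x∈X) (extend-into σ y∈X) σx<σy
    ... | p rewrite extend-inverseˡ σ x | extend-inverseˡ σ y = p

    RespectsOutside : Automorphism (induced X) → Set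
    RespectsOutside σ = ∀ {x y} → x ∈ X → y ∉ X →
      (x < y → extend X σ x < y) × (y < x → y < extend X σ x)

    -- Only pairs with one point inside `X` and one outside are at issue. The hypothesis ranges over
    -- all `σ` because order reflection is monotonicity of the extended inverse.
    extend-isAutomorphism : (∀ σ → RespectsOutside σ) → ∀ σ → IsAutomorphism poset (extend X σ)
    extend-isAutomorphism respects σ = record
      { isOrderMonomorphism = record
        { isOrderHomomorphism = record { cong = cong g ; mono = mono σ }
        ; injective = λ {x} {y} eq →
            trans (sym (extend-inverseˡ σ x)) (trans (cong g⁻¹ eq) (extend-inverseˡ σ y))
        ; cancel = λ {x} {y} gx≤gy →
            subst (_≤ y) (extend-inverseˡ σ x)
              (subst (g⁻¹ (g x) ≤_) (extend-inverseˡ σ y) (mono (σ AutX.⁻¹) gx≤gy))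
        }
      ; surjective = λ y → g⁻¹ y , λ { refl → extend-inverseʳ σ y }
      }
      where
      g   = extend X σ
      g⁻¹ = extend X (σ AutX.⁻¹)

      mono : ∀ σ {x y} → x ≤ y → extend X σ x ≤ extend X σ y
      mono σ {x} {y} x≤y with x ∈? X | y ∈? X
      ... | yes x∈X | yes y∈X = IsOrderIsomorphism.mono (proj₂ σ) x≤y
      ... | yes x∈X | no  y∉X = subst (_≤ y) (extend-∈ σ x∈X)
        (proj₁ (proj₁ (respects σ x∈X y∉X) (x≤y , λ { refl → y∉X x∈X })))
      ... | no  x∉X | yes y∈X = subst (x ≤_) (extend-∈ σ y∈X)
        (proj₁ (proj₂ (respects σ y∈X x∉X) (x≤y , λ { refl → x∉X y∈X })))
      ... | no  _   | no  _   = x≤y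

  -- Restricting automorphisms of `P` to invariant subsets.

  module _ (φ : Automorphism poset) where
    private module Φ = IsOrderIsomorphism (proj₂ φ)

    aut-mono-< : ∀ {x y} → x < y → proj₁ φ x < proj₁ φ y
    aut-mono-< (x≤y , x≢y) = Φ.mono x≤y , x≢y ∘ Φ.injective

    aut-cancel-< : ∀ {x y} → proj₁ φ x < proj₁ φ y → x < y
    aut-cancel-< (φx≤φy , φx≢φy) = Φ.cancel φx≤φy , φx≢φy ∘ cong (proj₁ φ)

    aut-surjective : ∀ y → ∃[ x ] proj₁ φ x ≡ y
    aut-surjective y = proj₁ (Φ.surjective y) , proj₂ (Φ.surjective y) refl

    restrict : (X : Subset n) → (∀ {x} → x ∈ X → proj₁ φ x ∈ X) →
               (∀ {x} → x ∈ X → proj₁ (aut-surjective x) ∈ X) → Automorphism (induced X)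
    restrict X φ-into φ⁻¹-into = (λ (x , x∈X) → proj₁ φ x , φ-into x∈X) , record
      { isOrderMonomorphism = record
        { isOrderHomomorphism = record { cong = cong (proj₁ φ) ; mono = Φ.mono }
        ; injective = Φ.injective
        ; cancel    = Φ.cancel
        }
      ; surjective = λ (y , y∈X) → (proj₁ (aut-surjective y) , φ⁻¹-into y∈X) ,
                                   λ { refl → proj₂ (aut-surjective y) }
      }

  -- Products of automorphisms evaluated at a point.

  private
    module AutP = Group (Aut poset)
  open MonoidSum AutP.monoid using () renaming (sum to ∏)

  ∏-fixes : ∀ {m} (t : Fin m → Automorphism poset) {x} →
            (∀ i → proj₁ (t i) x ≡ x) → proj₁ (∏ t) x ≡ x
  ∏-fixes {zero}  t fixes = refl
  ∏-fixes {suc m} t fixes =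
    trans (cong (proj₁ (t zero)) (∏-fixes (t ∘ suc) (fixes ∘ suc))) (fixes zero)

  -- The rightmost factor acts first: factors of index above `i` meet `x`, those of index below `i`
  -- meet its image under `t i`. Hence the two hypotheses.
  ∏-single : ∀ {m} (t : Fin m → Automorphism poset) {x} i →
             (∀ {j} → j ≢ i → proj₁ (t j) x ≡ x) →
             (∀ {j} → j ≢ i → proj₁ (t j) (proj₁ (t i) x) ≡ proj₁ (t i) x) →
             proj₁ (∏ t) x ≡ proj₁ (t i) x
  ∏-single t zero    before after =
    cong (proj₁ (t zero)) (∏-fixes (t ∘ suc) (λ j → before λ ()))
  ∏-single t (suc i) before after = trans
    (cong (proj₁ (t zero)) (∏-single (t ∘ suc) i (λ j≢i → before (j≢i ∘ suc-injective))
                                                 (λ j≢i → after (j≢i ∘ suc-injective))))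
    (after λ ())

-- The parts partition `P`.

module Decomposition {n : ℕ} (P : FinPoset n) (P-free : FinPoset.ThreePlusOneFree P)
  {r s : ℕ} (C : Fin r → Subset n) (T : Fin s → Subset n × Subset n)
  (enumC : Enumerates (FinPoset.IsCloneSet P) C) (enumT : Enumerates (FinPoset.IsTangle P) T) where
  open FinPoset P
  open Parts C T

  private
    O : FreeOrder n
    O = strictOrder P P-free
    module Down  = Crossings O
    module Up    = Crossings (dual O)
    module EnumC = Enumerates enumC
    module EnumT = Enumerates enumT
    module AutP  = Group (Aut poset)
    module ∏A    = Group ∏Aut

    tops bottoms : Fin s → Subset n
    tops    = proj₁ ∘ T
    bottoms = proj₂ ∘ T

    tangleAt : ∀ j → Tangle _<_ (tops j) (bottoms j)
    tangleAt j = isTangle⇒tangle P (EnumT.sound j)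

  outside⇒inNoTangle : ∀ {x} → (∀ j → x ∉ tangle j) → InNoTangle x
  outside⇒inNoTangle x∉ A B isT x∈ with EnumT.complete isT
  ... | j , refl = x∉ j x∈

  inNoTangle⇒outside : ∀ {x} → InNoTangle x → ∀ j → x ∉ tangle j
  inNoTangle⇒outside none j = none _ _ (EnumT.sound j)

  -- `InNoTangle` ranges over all pairs of subsets; the enumeration `T` reduces it to a finite
  -- check.
  inNoTangle? : Unary.Decidable InNoTangle
  inNoTangle? x = map′ outside⇒inNoTangle inNoTangle⇒outside (all? (λ j → ¬? (x ∈? tangle j)))

  _≋?_ : Decidable _≋_
  a ≋? b = (Down.⊆-dec a b ×-dec Down.⊆-dec b a) ×-dec (Up.⊆-dec a b ×-dec Up.⊆-dec b a)

  -- A ⊤-edge at `x` carries a square with `x` as a top, and the tangle of that square would contain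
  -- `x`.
  inNoTangle⇒¬⊤ : ∀ {x y} → InNoTangle x → ¬ (x ⊤ y)
  inNoTangle⇒¬⊤ none x⊤y with Down.crossing⇒square x⊤y
  ... | _ , _ , sq = square⇒¬¬tangle P sq
    λ (A , B , isT , x∈A , _) → none A B isT (x∈p∪q⁺ (inj₁ x∈A))

  inNoTangle⇒¬⊥ : ∀ {x y} → InNoTangle x → ¬ (x ⊥ y)
  inNoTangle⇒¬⊥ none x⊥y with Up.crossing⇒square x⊥y
  ... | _ , _ , sq = square⇒¬¬tangle P (square-dual {_≺_ = flip _<_} sq)
    λ (A , B , isT , _ , x∈B) → none A B isT (x∈p∪q⁺ {p = A} (inj₂ x∈B))

  -- A common point on the same side determines the tangle; on opposite sides it would lie on both a
  -- ⊤-edge and a ⊥-edge.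
  tangle-unique : ∀ {i j x} → x ∈ tangle i → x ∈ tangle j → i ≡ j
  tangle-unique {i} {j} x∈i x∈j with x∈p∪q⁻ _ _ x∈i | x∈p∪q⁻ _ _ x∈j
  ... | inj₁ x∈A | inj₁ x∈A′ with top-determines-tangle O (tangleAt i) (tangleAt j) x∈A x∈A′
  ...   | A≡ , B≡ = EnumT.injective (cong₂ _,_ A≡ B≡)
  tangle-unique {i} {j} x∈i x∈j | inj₁ x∈A | inj₂ x∈B =
    contradiction x∈B (top-bottom-disjoint O (tangleAt i) (tangleAt j) x∈A)
  tangle-unique {i} {j} x∈i x∈j | inj₂ x∈B | inj₁ x∈A =
    contradiction x∈B (top-bottom-disjoint O (tangleAt j) (tangleAt i) x∈A)
  tangle-unique {i} {j} x∈i x∈j | inj₂ x∈B | inj₂ x∈B′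
    with top-determines-tangle (dual O) (tangle-dual (tangleAt i)) (tangle-dual (tangleAt j)) x∈B x∈B′
  ...   | B≡ , A≡ = EnumT.injective (cong₂ _,_ A≡ B≡)

  ≋-sym : ∀ {a b} → a ≋ b → b ≋ a
  ≋-sym (d , u) = swap d , swap u

  ≋-trans : ∀ {a b c} → a ≋ b → b ≋ c → a ≋ c
  ≋-trans ((d₁ , d₂) , (u₁ , u₂)) ((d₃ , d₄) , (u₃ , u₄)) =
    ((λ p → d₃ (d₁ p)) , (λ p → d₂ (d₄ p))) , ((λ p → u₃ (u₁ p)) , (λ p → u₂ (u₄ p)))

  cloneSet-outside : ∀ i {x} → x ∈ C i → InNoTangle x
  cloneSet-outside i {x} x∈C = proj₁ (Equivalence.to (proj₂ (proj₂ (EnumC.sound i)) x) x∈C)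

  cloneSet-≋ : ∀ i {x y} → x ∈ C i → y ∈ C i → x ≋ y
  cloneSet-≋ i {x} {y} x∈C y∈C = ≋-trans (to x x∈C) (≋-sym (to y y∈C))
    where to = λ z z∈C → proj₂ (Equivalence.to (proj₂ (proj₂ (EnumC.sound i)) z) z∈C)

  cloneSet-closed : ∀ i {x y} → x ∈ C i → InNoTangle y → y ≋ x → y ∈ C i
  cloneSet-closed i {x} {y} x∈C y-out y≋x with EnumC.sound i
  ... | c , _ , C⇔ = Equivalence.from (C⇔ y)
                       (y-out , ≋-trans y≋x (proj₂ (Equivalence.to (C⇔ x) x∈C)))

  cloneSet-unique : ∀ {i j x} → x ∈ C i → x ∈ C j → i ≡ j
  cloneSet-unique {i} {j} x∈i x∈j = EnumC.injective (⊆-antisym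
    (λ y∈i → cloneSet-closed j x∈j (cloneSet-outside i y∈i) (cloneSet-≋ i y∈i x∈i))
    (λ y∈j → cloneSet-closed i x∈i (cloneSet-outside j y∈j) (cloneSet-≋ j y∈j x∈j)))

  part-unique : ∀ {k l x} → x ∈ part k → x ∈ part l → k ≡ l
  part-unique {inj₁ i} {inj₁ j} x∈k x∈l = cong inj₁ (cloneSet-unique x∈k x∈l)
  part-unique {inj₁ i} {inj₂ j} x∈k x∈l =
    contradiction x∈l (inNoTangle⇒outside (cloneSet-outside i x∈k) j)
  part-unique {inj₂ i} {inj₁ j} x∈k x∈l =
    contradiction x∈k (inNoTangle⇒outside (cloneSet-outside j x∈l) i)
  part-unique {inj₂ i} {inj₂ j} x∈k x∈l = cong inj₂ (tangle-unique x∈k x∈l)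

  part-exists : ∀ x → ∃[ k ] x ∈ part k
  part-exists x with any? (λ j → x ∈? tangle j)
  ... | yes (j , x∈j) = inj₂ j , x∈j
  ... | no  none = inj₁ (proj₁ found) , subst (x ∈_) (sym (proj₂ found))
                     (Equivalence.from (∈-comprehension clone? x) (x-out , ≋-refl))
    where
    x-out : InNoTangle x
    x-out = outside⇒inNoTangle (λ j x∈j → none (j , x∈j))
    ≋-refl : x ≋ x
    ≋-refl = ((λ p → p) , (λ p → p)) , ((λ p → p) , (λ p → p))
    clone? : Unary.Decidable (λ y → InNoTangle y × y ≋ x)
    clone? y = inNoTangle? y ×-dec (y ≋? x)
    -- The clones of `x` outside all tangles form a clone set, and completeness of the enumeration
    -- locates it in `C`.
    found = EnumC.complete (x , x-out , ∈-comprehension clone?)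

  part-partition : ∀ x → ∃! _≡_ (λ k → x ∈ part k)
  part-partition x with part-exists x
  ... | k , x∈k = k , x∈k , part-unique x∈k

  -- Automorphisms of the parts extend to `P`.

  respectsOutside : ∀ k σ → RespectsOutside P (part k) σ
  -- The image of a point of a clone set is a clone of it, so both have the same relations to every
  -- point of `P`.
  respectsOutside (inj₁ i) σ x∈X y∉X with cloneSet-≋ i x∈X (extend-into P (C i) σ x∈X)
  ... | (D⊆ , _) , (U⊆ , _) = U⊆ , D⊆
  respectsOutside (inj₂ j) σ {x} {y} x∈X y∉X = [ onTop , onBottom ]′ (x∈p∪q⁻ _ _ x∈X)
    where
    t   = tangleAt j
    g   = extend (tangle j) σ
    inA : ∀ {x} → x ∈ tops j → x ∈ tangle j
    inA = x∈p∪q⁺ ∘ inj₁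
    inB : ∀ {x} → x ∈ bottoms j → x ∈ tangle j
    inB = x∈p∪q⁺ {p = tops j} ∘ inj₂

    g-top : ∀ {a} → a ∈ tops j → g a ∈ tops j
    g-top = top-preserved O t g
      (λ a∈A → x∈p∪q⁻ _ _ (extend-into P _ σ (inA a∈A)))
      (λ a∈A b∈B → extend-mono-<-∈ P _ σ (inB b∈B) (inA a∈A) ,
                   extend-cancel-<-∈ P _ σ (inB b∈B) (inA a∈A))

    g-bottom : ∀ {b} → b ∈ bottoms j → g b ∈ bottoms j
    g-bottom = top-preserved (dual O) (tangle-dual t) g
      (λ b∈B → [ inj₂ , inj₁ ]′ (x∈p∪q⁻ (tops j) _ (extend-into P _ σ (inB b∈B))))
      (λ b∈B a∈A → extend-mono-<-∈ P _ σ (inB b∈B) (inA a∈A) ,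
                   extend-cancel-<-∈ P _ σ (inB b∈B) (inA a∈A))

    -- Since `g x` stays in the top, a ⊤-path joins it to `x`. Such paths preserve the points above,
    -- and also those points below that lie outside the bottom.
    onTop : x ∈ tops j → (x < y → g x < y) × (y < x → y < g x)
    onTop x∈A =
      Down.star⇒above (ClosedConnected.connected (Tangle.top t) x∈A (g-top x∈A)) ,
      Down.top-below-outside t x∈A (g-top x∈A) (y∉X ∘ inB)

    onBottom : x ∈ bottoms j → (x < y → g x < y) × (y < x → y < g x)
    onBottom x∈B =
      Up.top-below-outside (tangle-dual t) x∈B (g-bottom x∈B) (y∉X ∘ inA) ,
      Up.star⇒above (ClosedConnected.connected (Tangle.bottom t) x∈B (g-bottom x∈B))

  extendsToAut : ExtendsToAut
  extendsToAut k = extend-isAutomorphism P (part k) (respectsOutside k)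

  -- Automorphisms of `P` preserve the parts.

  tangle-invariant : ∀ (φ : Automorphism poset) j {x} → x ∈ tangle j → proj₁ φ x ∈ tangle j
  tangle-invariant φ j x∈X with x∈p∪q⁻ (tops j) _ x∈X
  ... | inj₁ x∈A = x∈p∪q⁺ (inj₁ (Down.crossing-closed-invariant
    (IsOrderIsomorphism.injective (proj₂ φ)) (aut-surjective P φ) (aut-mono-< P φ) (aut-cancel-< P φ)
    (Tangle.top (tangleAt j)) (Down.top-crossing (tangleAt j)) x∈A))
  ... | inj₂ x∈B = x∈p∪q⁺ {p = tops j} (inj₂ (Up.crossing-closed-invariant
    (IsOrderIsomorphism.injective (proj₂ φ)) (aut-surjective P φ) (aut-mono-< P φ) (aut-cancel-< P φ)
    (Tangle.bottom (tangleAt j)) (Up.top-crossing (tangle-dual (tangleAt j))) x∈B))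

  -- A point of a clone set is on no ⊤-edge or ⊥-edge, so its down-set and up-set equal those of its
  -- image. The image avoids all tangles, since the inverse of `φ` would carry a tangle point back
  -- into the same tangle.
  part-invariant : ∀ (φ : Automorphism poset) k {x} → x ∈ part k → proj₁ φ x ∈ part k
  part-invariant φ (inj₂ j) = tangle-invariant φ j
  part-invariant φ (inj₁ i) {x} x∈C = cloneSet-closed i x∈C φx-out
    ( ((λ {y} → proj₂ (D≡ y)) , (λ {y} → proj₁ (D≡ y)))
    , ((λ {y} → proj₂ (U≡ y)) , (λ {y} → proj₁ (U≡ y))))
    where
    x-out = cloneSet-outside i x∈C
    D≡ = Down.nested⇒equal (IsOrderIsomorphism.injective (proj₂ φ)) (aut-surjective P φ)
           (aut-mono-< P φ) (aut-cancel-< P φ) (inNoTangle⇒¬⊤ x-out)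
    U≡ = Up.nested⇒equal (IsOrderIsomorphism.injective (proj₂ φ)) (aut-surjective P φ)
           (aut-mono-< P φ) (aut-cancel-< P φ) (inNoTangle⇒¬⊥ x-out)
    φx-out : InNoTangle (proj₁ φ x)
    φx-out = outside⇒inNoTangle λ j φx∈j → inNoTangle⇒outside x-out j
      (subst (_∈ tangle j) (AutP.inverseˡ φ x) (tangle-invariant (φ AutP.⁻¹) j φx∈j))

  -- The natural map is a group isomorphism.

  factor : ∏A.Carrier → ∀ k → Automorphism (induced (part k))
  factor (σ , τ) (inj₁ i) = σ i
  factor (σ , τ) (inj₂ j) = τ j

  Φ : ∏A.Carrier → Automorphism poset
  Φ = naturalMap extendsToAut

  private
    act : ∏A.Carrier → ∀ k → Fin n → Fin n
    act g k = extend (part k) (factor g k)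

    act-other : ∀ g {k l x} → x ∈ part k → l ≢ k → act g l x ≡ x
    act-other g {k} {l} x∈k l≢k =
      extend-∉ P (part l) (factor g l) (λ x∈l → l≢k (part-unique x∈l x∈k))

    act-into : ∀ g k {x} → x ∈ part k → act g k x ∈ part k
    act-into g k = extend-into P (part k) (factor g k)

    open MonoidSum AutP.monoid using () renaming (sum to ∏)

    clones : ∏A.Carrier → Fin r → Automorphism poset
    clones g i = act g (inj₁ i) , extendsToAut (inj₁ i) (factor g (inj₁ i))

    tangles : ∏A.Carrier → Fin s → Automorphism poset
    tangles g j = act g (inj₂ j) , extendsToAut (inj₂ j) (factor g (inj₂ j))

  -- Only the factor of the part containing `x` can move `x`, and the image stays in that part,
  -- where the other factors are the identity. The group laws for `Φ` are thereby checked part by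
  -- part.
  naturalMap-on-part : ∀ g k {x} → x ∈ part k → proj₁ (Φ g) x ≡ act g k x
  naturalMap-on-part g (inj₁ i) {x} x∈k = trans
    (cong (proj₁ (∏ (clones g)))
      (∏-fixes P (tangles g) λ j → act-other g {inj₁ i} {inj₂ j} x∈k λ ()))
    (∏-single P (clones g) i
      (λ {j} j≢i → act-other g {inj₁ i} {inj₁ j} x∈k (j≢i ∘ inj₁-injective))
      (λ {j} j≢i → act-other g {inj₁ i} {inj₁ j} (act-into g (inj₁ i) x∈k) (j≢i ∘ inj₁-injective)))
  naturalMap-on-part g (inj₂ j) {x} x∈k = trans
    (cong (proj₁ (∏ (clones g))) (∏-single P (tangles g) j
      (λ {l} l≢j → act-other g {inj₂ j} {inj₂ l} x∈k (l≢j ∘ inj₂-injective))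
      (λ {l} l≢j → act-other g {inj₂ j} {inj₂ l} (act-into g (inj₂ j) x∈k) (l≢j ∘ inj₂-injective))))
    (∏-fixes P (clones g) λ i → act-other g {inj₂ j} {inj₁ i} (act-into g (inj₂ j) x∈k) λ ())

  Φ-cong : ∀ {g h} → g ∏A.≈ h → Φ g AutP.≈ Φ h
  Φ-cong {g} {h} (p , q) x = let k , x∈k = part-exists x in
    trans (naturalMap-on-part g k x∈k)
    (trans (extend-cong P (part k) {factor g k} {factor h k} (factor-≈ k) x)
           (sym (naturalMap-on-part h k x∈k)))
    where
    factor-≈ : ∀ k → Group._≈_ (Aut (induced (part k))) (factor g k) (factor h k)
    factor-≈ (inj₁ i) = p i
    factor-≈ (inj₂ j) = q j

  Φ-∙ : ∀ g h → Φ (g ∏A.∙ h) AutP.≈ (Φ g AutP.∙ Φ h)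
  Φ-∙ g h x = let k , x∈k = part-exists x in
    trans (naturalMap-on-part (g ∏A.∙ h) k x∈k) (trans (act-∙ k)
    (trans (sym (naturalMap-on-part g k (act-into h k x∈k)))
           (cong (proj₁ (Φ g)) (sym (naturalMap-on-part h k x∈k)))))
    where
    act-∙ : ∀ k → act (g ∏A.∙ h) k x ≡ act g k (act h k x)
    -- `factor` reduces only once it is known whether `k` indexes a clone set or a tangle.
    act-∙ (inj₁ i) = extend-∙ P (C i) (factor g (inj₁ i)) (factor h (inj₁ i)) x
    act-∙ (inj₂ j) = extend-∙ P (tangle j) (factor g (inj₂ j)) (factor h (inj₂ j)) x

  Φ-ε : Φ ∏A.ε AutP.≈ AutP.ε
  Φ-ε x = let k , x∈k = part-exists x in
    trans (naturalMap-on-part ∏A.ε k x∈k) (act-ε k)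
    where
    act-ε : ∀ k → act ∏A.ε k x ≡ x
    act-ε (inj₁ i) = extend-ε P (C i) x
    act-ε (inj₂ j) = extend-ε P (tangle j) x

  Φ-⁻¹ : ∀ g → Φ (g ∏A.⁻¹) AutP.≈ (Φ g AutP.⁻¹)
  Φ-⁻¹ g = GroupProperties.inverseˡ-unique (Aut poset) (Φ (g ∏A.⁻¹)) (Φ g) λ x →
    trans (sym (Φ-∙ (g ∏A.⁻¹) g x)) (trans (Φ-cong {(g ∏A.⁻¹) ∏A.∙ g} {∏A.ε} (∏A.inverseˡ g) x) (Φ-ε x))

  Φ-injective : ∀ {g h} → Φ g AutP.≈ Φ h → g ∏A.≈ h
  Φ-injective {g} {h} eq = (λ i → factor-≈ (inj₁ i)) , (λ j → factor-≈ (inj₂ j))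
    where
    factor-≈ : ∀ k → Group._≈_ (Aut (induced (part k))) (factor g k) (factor h k)
    factor-≈ k (x , x∈k) =
      trans (sym (extend-∈ P (part k) (factor g k) x∈k))
      (trans (sym (naturalMap-on-part g k x∈k))
      (trans (eq x)
      (trans (naturalMap-on-part h k x∈k)
             (extend-∈ P (part k) (factor h k) x∈k))))

  preimage : Automorphism poset → ∏A.Carrier
  preimage φ = (λ i → restrictTo (inj₁ i)) , (λ j → restrictTo (inj₂ j))
    where
    restrictTo : ∀ k → Automorphism (induced (part k))
    -- Invariance under the inverse of `φ` makes the restriction surjective.
    restrictTo k = restrict P φ (part k) (part-invariant φ k) (part-invariant (φ AutP.⁻¹) k)

  Φ-preimage : ∀ φ → Φ (preimage φ) AutP.≈ φ
  Φ-preimage φ x = let k , x∈k = part-exists x in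
    trans (naturalMap-on-part (preimage φ) k x∈k) (act-preimage k x∈k)
    where
    act-preimage : ∀ k → x ∈ part k → act (preimage φ) k x ≡ proj₁ φ x
    act-preimage (inj₁ i) = extend-∈ P (C i) (factor (preimage φ) (inj₁ i))
    act-preimage (inj₂ j) = extend-∈ P (tangle j) (factor (preimage φ) (inj₂ j))

  open GroupMorphisms (Group.rawGroup ∏Aut) (Group.rawGroup (Aut poset))

  Φ-isGroupIsomorphism : IsGroupIsomorphism Φ
  Φ-isGroupIsomorphism = record
    { isGroupMonomorphism = record
      { isGroupHomomorphism = record
        { isMonoidHomomorphism = record
          { isMagmaHomomorphism = record
            { isRelHomomorphism = record { cong = λ {g} {h} → Φ-cong {g} {h} }
            ; homo = Φ-∙
            }
          ; ε-homo = Φ-ε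
          }
        ; ⁻¹-homo = Φ-⁻¹
        }
      ; injective = λ {g} {h} → Φ-injective {g} {h}
      }
    ; surjective = λ φ → preimage φ , λ {g} g≈ x →
        trans (Φ-cong {g} {preimage φ} g≈ x) (Φ-preimage φ x)
    }

theorem2p14 : ∀ {n : ℕ} (P : FinPoset n) → let open FinPoset P in
    ThreePlusOneFree →
    ∀ {r s : ℕ} (C : Fin r → Subset n) (T : Fin s → Subset n × Subset n) →
    Enumerates IsCloneSet C → Enumerates IsTangle T →
    let open Parts C T
        open GroupMorphisms (Group.rawGroup ∏Aut) (Group.rawGroup (Aut poset))
    in (∀ x → ∃! _≡_ (λ k → x ∈ part k)) ×
       (Σ[ ext ∈ ExtendsToAut ] IsGroupIsomorphism (naturalMap ext))
theorem2p14 P P-free C T enumC enumT = part-partition , extendsToAut , Φ-isGroupIsomorphism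
  where open Decomposition P P-free C T enumC enumT
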